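{- Let $R\subseteq\Lambda^\infty\times\Lambda^\infty$ be such that $\to_R$ is appendable. Then for all $s,t\in\Lambda^\infty$: $s\to^\infty_R t$ if and only if there exists a strongly convergent $R$-reduction sequence from $s$ to $t$. Moreover, if $s\to^\infty_R t$ then such a sequence may be chosen to have length at most $\omega$.
   Context: Fix an infinite set $V$ of variables and a set $C$ of constants with $V\cap C=\emptyset$, containing a distinguished constant $\bot$. $\Lambda^\infty$ is the set of infinitary lambda-terms: all finite and infinite terms generated coinductively by $t ::= c\mid x\mid t\,t\mid\lambda x.t$, identified up to $\alpha$-equivalence; $\equiv$ is identity of terms; an atom is a variable or constant. For $R\subseteq\Lambda^\infty\times\Lambda^\infty$, the compatible closure $\to_R$ is the least relation with: $(s,t)\in R\Rightarrow s\to_R t$; $s\to_R s'\Rightarrow st\to_R s't,\ ts\to_R ts',\ \lambda x.s\to_R\lambda x.s'$ (so a contraction step contracts an $R$-redex at some finite depth). For a relation $\to$ with reflexive-transitive closure $\to^*$, its infinitary closure $\to^\infty$ is the greatest relation such that whenever $s\to^\infty t$: $t\equiv a$ atom and $s\to^*a$; or $t\equiv t_1't_2'$, $s\to^*t_1t_2$, $t_i\to^\infty t_i'$; or $t\equiv\lambda x.r'$, $s\to^*\lambda x.r$, $r\to^\infty r'$. $\to^\infty_R$ is the infinitary closure of $\to_R$. A relation $\to$ is appendable if $t_1\to^\infty t_2\to t_3$ implies $t_1\to^\infty t_3$. Metric on $\Lambda^\infty$: $d(t,s)=\inf\{2^{ -n}\mid t^{\upharpoonright n}\equiv s^{\upharpoonright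 n}\}$ where $r^{\upharpoonright n}$ is $r$ with all subterms at depth $n$ replaced by $\bot$. For an ordinal $\alpha$, a strongly convergent $R$-reduction sequence of length $\alpha$ from $f(0)$ to $f(\alpha)$ is a map $f:\{\beta\le\alpha\}\to\Lambda^\infty$ together with contraction steps $\sigma_\beta:f(\beta)\to_R f(\beta+1)$ for $\beta<\alpha$ such that for every limit ordinal $\gamma\le\alpha$: (1) $f(\gamma)$ is the limit in the metric topology of $(f(\beta))_{\beta<\gamma}$, and (2) for every $d\in\mathbb{N}$ there is $\beta<\gamma$ such that for all $\beta'$ with $\beta\le\beta'<\gamma$ the redex contracted in $\sigma_{\beta'}$ occurs at depth greater than $d$.
   Formalization: The claim fails for appendable R that depend on the name chosen for a bound variable, since a sequence may rename a binder infinitely often; it is stated for terms with nameless (de Bruijn) binders, so it covers those R whose steps under a binder do not depend on the bound variable's name. -}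

module Defs where

open import Data.Integer.Base using (+_)
open import Data.List.Base using (List; []; _∷_)
open import Data.Maybe.Base using (Maybe; just; nothing)
open import Data.Nat.Base as ℕ using (ℕ; zero; suc)
open import Data.Nat.Induction using (<-wellFounded)
open import Data.Nat.Properties using (m^n≢0; <-isStrictTotalOrder)
open import Data.Product.Base using (∃; Σ; _×_)
open import Data.Rational.Unnormalised.Base as ℚ using (ℚᵘ; Positive)
open import Induction.WellFounded using (WellFounded)
open import Level using (Level; _⊔_; 0ℓ) renaming (suc to lsuc)
open import Relation.Binary.Construct.Closure.ReflexiveTransitive using (Star)
open import Relation.Binary.Construct.Union using (_∪_)
open import Relation.Binary.Core using (Rel; _Preserves_⟶_)
open import Relation.Binary.PropositionalEquality.Core using (_≡_)
open import Relation.Binary.Structures using (IsStrictTotalOrder)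
open import Relation.Nullary.Construct.Add.Supremum using (_⁺; [_]; ⊤⁺)
open import Relation.Nullary.Negation.Core using (¬_)

import Relation.Binary.Construct.Add.Supremum.Strict as Supremum
import Relation.Binary.Construct.StrictToNonStrict as NonStrict

------------------------------------------------------------------------
-- Ordinals, as well-ordered types

record Ordinal : Set₁ where
  infix 4 _<_
  field
    Carrier            : Set
    _<_                : Rel Carrier 0ℓ
    isStrictTotalOrder : IsStrictTotalOrder _≡_ _<_
    wellFounded        : WellFounded _<_

  open NonStrict _≡_ _<_ public using (_≤_)

  -- For an ordinal α, Carrier is { β | β < α } and Carrier ⁺ is
  -- { β | β ≤ α }, with ⊤⁺ standing for α itself.
  open Supremum _<_ public using (_<⁺_)

  IsZero : Carrier ⁺ → Set
  IsZero γ = ∀ β → ¬ (β <⁺ γ)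

  IsSuccessorOf : Carrier → Carrier ⁺ → Set
  IsSuccessorOf β γ = [ β ] <⁺ γ × (∀ δ → [ β ] <⁺ δ → ¬ (δ <⁺ γ))

  IsLimit : Carrier ⁺ → Set
  IsLimit γ = ∃ (λ β → [ β ] <⁺ γ)
            × (∀ β → [ β ] <⁺ γ → ∃ λ δ → β < δ × [ δ ] <⁺ γ)

open Ordinal using (Carrier)

ω : Ordinal
ω = record
  { Carrier            = ℕ
  ; _<_                = ℕ._<_
  ; isStrictTotalOrder = <-isStrictTotalOrder
  ; wellFounded        = <-wellFounded
  }

-- α ≼ β: α is order-isomorphic to an initial segment of β.
infix 4 _≼_

_≼_ : Ordinal → Ordinal → Set
α ≼ β = ∃ λ (g : Carrier α → Carrier β)
      → g Preserves A._<_ ⟶ B._<_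
      × (∀ x y → y B.< g x → ∃ λ x′ → x′ A.< x × g x′ ≡ y)
  where
  module A = Ordinal α
  module B = Ordinal β

2⁻_ : ℕ → ℚᵘ
2⁻ n = (+ 1 ℚ./ 2 ℕ.^ n) {{m^n≢0 2 n}}

------------------------------------------------------------------------
-- Infinitary λ-terms over a set C of constants.
--
-- α-equivalence classes are represented by de Bruijn terms: below k
-- abstractions, the variable i is bound by the i-th enclosing
-- abstraction (counted inside out, from 0) if i < k, and is the free
-- variable i ∸ k otherwise.

module Terms {c : Level} (C : Set c) (⊥ᶜ : C) where

  data Atom : Set c where
    con : C → Atom
    var : ℕ → Atom

  data Symbol : Set c where
    atom    : Atom → Symbol
    app lam : Symbol

  data Dir : Set where
    fun arg body : Dir

  -- A finite or infinite term, given by the symbols at its positions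
  -- (paths from the root).  Paths that leave the tree carry irrelevant
  -- symbols, which _‼_ and hence _≈_ disregard.
  record Λ∞ : Set c where
    constructor tree
    field
      symbol : List Dir → Symbol

    root : Symbol
    root = symbol []

  open Λ∞ public

  _/_ : Λ∞ → Dir → Λ∞
  (t / d) .symbol p = symbol t (d ∷ p)

  infixl 20 _·_

  ⌜_⌝ : Atom → Λ∞
  ⌜ a ⌝ .symbol _ = atom a

  _·_ : Λ∞ → Λ∞ → Λ∞
  (s · t) .symbol []         = app
  (s · t) .symbol (fun  ∷ p) = symbol s p
  (s · t) .symbol (arg  ∷ p) = symbol t p
  (s · t) .symbol (body ∷ p) = app

  ƛ : Λ∞ → Λ∞
  ƛ s .symbol []         = lam
  ƛ s .symbol (fun  ∷ p) = lam
  ƛ s .symbol (arg  ∷ p) = lam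
  ƛ s .symbol (body ∷ p) = symbol s p

  -- The symbol at a position, if the position belongs to the term.
  _‼_ : Λ∞ → List Dir → Maybe Symbol
  t ‼ [] = just (root t)
  t ‼ (d ∷ p) with root t | d
  ... | app | fun  = (t / fun) ‼ p
  ... | app | arg  = (t / arg) ‼ p
  ... | lam | body = (t / body) ‼ p
  ... | _   | _    = nothing

  -- Identity of terms.
  infix 4 _≈_

  _≈_ : Rel Λ∞ c
  s ≈ t = ∀ p → s ‼ p ≡ t ‼ p

  infixl 25 _↾_

  _↾_ : Λ∞ → ℕ → Λ∞
  r ↾ zero = ⌜ con ⊥ᶜ ⌝
  r ↾ suc n with root r
  ... | atom a = ⌜ a ⌝
  ... | app    = (r / fun) ↾ n · (r / arg) ↾ n
  ... | lam    = ƛ ((r / body) ↾ n)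

  -- d(t , s) < ε, where d(t , s) = inf { 2⁻ⁿ | t ↾ n ≈ s ↾ n }: an
  -- infimum is below ε exactly when some member of the set is.
  dist[_,_]<_ : Λ∞ → Λ∞ → ℚᵘ → Set c
  dist[ t , s ]< ε = ∃ λ n → t ↾ n ≈ s ↾ n × 2⁻ n ℚ.< ε

  module _ {ℓ : Level} (_⟶_ : Rel Λ∞ ℓ) where

    -- Reflexive-transitive closure; reflexivity is up to identity of
    -- terms.
    RTC : Rel Λ∞ (c ⊔ ℓ)
    RTC = Star (_≈_ ∪ _⟶_)

    data InfClause {x} (X : Rel Λ∞ x) (s t : Λ∞) : Set (c ⊔ ℓ ⊔ x) where
      atom : ∀ a → t ≈ ⌜ a ⌝ → RTC s ⌜ a ⌝ → InfClause X s t
      app  : ∀ {t₁ t₂ t₁′ t₂′} → t ≈ t₁′ · t₂′ → RTC s (t₁ · t₂) →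
             X t₁ t₁′ → X t₂ t₂′ → InfClause X s t
      lam  : ∀ {r r′} → t ≈ ƛ r′ → RTC s (ƛ r) →
             X r r′ → InfClause X s t

    -- The greatest relation satisfying the clauses, as the union of all
    -- relations X satisfying them.
    InfClosure : Rel Λ∞ (lsuc (c ⊔ ℓ))
    InfClosure s t = Σ (Rel Λ∞ (c ⊔ ℓ)) λ X →
      (∀ {u v} → X u v → InfClause X u v) × X s t

    Appendable : Set (lsuc (c ⊔ ℓ))
    Appendable = ∀ t₁ t₂ t₃ → InfClosure t₁ t₂ → t₂ ⟶ t₃ → InfClosure t₁ t₃

  module Reduction {r : Level} (R : Rel Λ∞ r) where

    infix 4 _⟶_ _⟶∞_

    -- Compatible closure.  The constructor ident makes it (and hence R)
    -- a relation on terms taken up to _≈_.  R is not assumed invariant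
    -- under renaming: below abs, R sees the bound variable as index 0.
    data _⟶_ : Rel Λ∞ (c ⊔ r) where
      redex : ∀ {s t} → R s t → s ⟶ t
      appˡ  : ∀ {s s′ t} → s ⟶ s′ → s · t ⟶ s′ · t
      appʳ  : ∀ {s s′ t} → s ⟶ s′ → t · s ⟶ t · s′
      abs   : ∀ {s s′} → s ⟶ s′ → ƛ s ⟶ ƛ s′
      ident : ∀ {s s′ t t′} → s ≈ s′ → s′ ⟶ t′ → t′ ≈ t → s ⟶ t

    -- Depth of the contracted redex.
    depth : ∀ {s t} → s ⟶ t → ℕ
    depth (redex _)     = 0
    depth (appˡ σ)      = suc (depth σ)
    depth (appʳ σ)      = suc (depth σ)
    depth (abs σ)       = suc (depth σ)
    depth (ident _ σ _) = depth σ

    _⟶∞_ : Rel Λ∞ (lsuc (c ⊔ r))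
    _⟶∞_ = InfClosure _⟶_

    -- Strongly convergent R-reduction sequences of length α from s to t.
    record StronglyConvergent (α : Ordinal) (s t : Λ∞) : Set (c ⊔ r) where
      open Ordinal α hiding (Carrier)
      field
        f         : Carrier α ⁺ → Λ∞

        least     : Carrier α ⁺
        least-ok  : IsZero least
        start     : f least ≈ s
        end       : f ⊤⁺ ≈ t

        -- β ↦ β + 1
        next      : Carrier α → Carrier α ⁺
        next-ok   : ∀ β → IsSuccessorOf β (next β)
        σ         : ∀ β → f [ β ] ⟶ f (next β)

        converges : ∀ γ → IsLimit γ → ∀ ε → Positive ε →
                    ∃ λ β → [ β ] <⁺ γ ×
                    (∀ β′ → β ≤ β′ → [ β′ ] <⁺ γ → dist[ f [ β′ ] , f γ ]< ε)

        deepens   : ∀ γ → IsLimit γ → ∀ d →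
                    ∃ λ β → [ β ] <⁺ γ ×
                    (∀ β′ → β ≤ β′ → [ β′ ] <⁺ γ → d ℕ.< depth (σ β′))

{-# OPTIONS --safe #-}

-- Unfolding s ⟶∞ t level by level gives finite reductions s = h₀ →* h₁ →* …,
-- where hₙ →* hₙ₊₁ contracts only redexes at depth ≥ n and hₙ agrees with t
-- to depth n.  Their concatenation is strongly convergent of length ≤ ω.
-- Conversely, along a strongly convergent sequence f one shows by transfinite
-- induction on γ, for all n and β ≤ γ such that the steps in [β , γ) have
-- depth ≥ n: if w develops to f β by infinitary reduction at depth ≥ n, then
-- w so develops to f γ.  Successors use appendability below depth n; at a
-- limit, f γ is approached through indices from which on the steps are ever
-- deeper.

module Submission where

open import Defs
open import Axiom.ExcludedMiddle using (ExcludedMiddle)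
open import Data.Bool.Base using (Bool; true; false; T; if_then_else_)
open import Data.Bool.Properties using (T-irrelevant; T?)
open import Data.Integer.Base as ℤ using (+_; +[1+_])
open import Data.List.Base using ([]; _∷_; length)
open import Data.Maybe.Base using (just; nothing)
open import Data.Maybe.Properties using (just-injective)
open import Data.Nat.Base hiding (_/_; compare)
open import Data.Nat.Induction using (<-wellFounded)
open import Data.Nat.Properties
open import Data.Product.Base using (∃; _×_; _,_; proj₁; proj₂)
open import Data.Rational.Unnormalised.Base as ℚ using (mkℚᵘ; Positive; *<*)
open import Data.Sum.Base using (_⊎_; inj₁; inj₂; [_,_]′)
open import Data.Unit.Polymorphic.Base using (⊤; tt)
open import Function.Base using (_∘_; id; _on_)
open import Function.Bundles using (_⇔_; mk⇔)
open import Induction.WellFounded using (Acc; acc)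
open import Level using (Level; 0ℓ) renaming (_⊔_ to _⊔ˡ_)
open import Relation.Binary.Construct.Closure.ReflexiveTransitive as Star using (Star; ε; _◅_; _◅◅_; gmap)
open import Relation.Binary.Core using (Rel)
open import Relation.Binary.Definitions using (Trichotomous; tri<; tri≈; tri>)
open import Relation.Binary.PropositionalEquality
open import Relation.Binary.Structures using (IsStrictTotalOrder; IsTotalOrder)
open import Relation.Nullary.Construct.Add.Supremum using (_⁺; [_]; ⊤⁺)
open import Relation.Nullary.Decidable using (Dec; yes; no)
open import Relation.Nullary.Negation using (¬_; contradiction)

import Data.Integer.Properties as ℤ
import Relation.Binary.Construct.Add.Supremum.Strict as Supremum
import Relation.Binary.Construct.On as On
import Relation.Binary.Construct.StrictToNonStrict as NonStrict

-- Powers of one half among the positive rationals.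

1/-positive : ∀ n .{{_ : NonZero n}} → Positive (+ 1 ℚ./ n)
1/-positive (suc n) = _

1/-cancel-< : ∀ m n .{{_ : NonZero m}} .{{_ : NonZero n}} → + 1 ℚ./ m ℚ.< + 1 ℚ./ n → n < m
1/-cancel-< (suc m) (suc n) (*<* lt) =
  ℤ.drop‿+<+ (subst₂ ℤ._<_ (ℤ.*-identityˡ (+ suc n)) (ℤ.*-identityˡ (+ suc m)) lt)

2⁻-positive : ∀ n → Positive (2⁻ n)
2⁻-positive n = 1/-positive (2 ^ n) {{m^n≢0 2 n}}

2⁻-cancel-≤ : ∀ m n → 2⁻ m ℚ.< 2⁻ n → n ≤ m
2⁻-cancel-≤ m n lt = ≮⇒≥ λ m<n →
  <⇒≱ (1/-cancel-< (2 ^ m) (2 ^ n) {{m^n≢0 2 m}} {{m^n≢0 2 n}} lt) (^-monoʳ-≤ 2 (<⇒≤ m<n))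

n<2^n : ∀ n → n < 2 ^ n
n<2^n zero    = s≤s z≤n
n<2^n (suc n) = +-mono-≤-< {1} (m^n>0 2 n) (subst (n <_) (sym (+-identityʳ (2 ^ n))) (n<2^n n))

2⁻-archimedean : ∀ ε → Positive ε → ∃ λ n → 2⁻ n ℚ.< ε
-- Here ε is (a + 1)/(b + 1), hence at least 1/(b + 1), and b + 1 < 2^(b + 1).
2⁻-archimedean (mkℚᵘ +[1+ a ] b) _ = suc b , bound (2 ^ suc b) {{m^n≢0 2 (suc b)}} (n<2^n (suc b))
  where
  bound : ∀ m .{{_ : NonZero m}} → suc b < m → + 1 ℚ./ m ℚ.< mkℚᵘ +[1+ a ] b
  bound (suc m) b<m = *<* (ℤ.+<+ (≤-trans (s≤s (≤-reflexive (+-identityʳ (suc b))))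
    (≤-trans b<m (m≤m+n (suc m) (a * suc m)))))

-- Decidable sets of natural numbers as ordinals of length at most ω.

module Restriction (P : ℕ → Bool) where

  -- `P` is Boolean so that `T (P n)` has at most one proof: elements with equal numbers are then
  -- equal, as trichotomy with respect to `_≡_` requires.
  ordinal : Ordinal
  ordinal = record
    { Carrier            = ∃ (T ∘ P)
    ; _<_                = _<_ on proj₁
    ; isStrictTotalOrder = record
      { isStrictPartialOrder = record
        { isEquivalence = isEquivalence
        ; irrefl        = λ { refl → <-irrefl refl }
        ; trans         = <-trans
        ; <-resp-≈      = (λ { refl → id }) , λ { refl → id }
        }
      ; compare = compare
      }
    ; wellFounded        = On.wellFounded proj₁ <-wellFounded
    }
    where
    compare : Trichotomous _≡_ (_<_ on proj₁)
    compare (m , p) (n , q) with <-cmp m n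
    ... | tri< m<n m≢n m≯n  = tri< m<n (m≢n ∘ cong proj₁) m≯n
    ... | tri≈ m≮m refl m≯m = tri≈ m≮m (cong (m ,_) (T-irrelevant p q)) m≯m
    ... | tri> m≮n m≢n m>n  = tri> m≮n (m≢n ∘ cong proj₁) m>n

  open Ordinal ordinal using (Carrier; IsLimit; _<⁺_)
  open Supremum (Ordinal._<_ ordinal) using ([_])

  -- The rank of n in `P`; on `P` it is the collapse onto an initial segment of ℕ.
  count : ℕ → ℕ
  count zero    = 0
  count (suc n) = if P n then suc (count n) else count n

  count-≤-suc : ∀ n → count n ≤ count (suc n)
  count-≤-suc n with P n
  ... | true  = n≤1+n _
  ... | false = ≤-refl

  count-mono : ∀ {m n} → m ≤′ n → count m ≤ count n
  count-mono ≤′-refl              = ≤-refl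
  count-mono (≤′-step {n = n} le) = ≤-trans (count-mono le) (count-≤-suc n)

  count-suc : ∀ m → T (P m) → count (suc m) ≡ suc (count m)
  count-suc m p with true ← P m = refl

  count-surjective : ∀ n y → y < count n → ∃ λ m → m < n × T (P m) × count m ≡ y
  count-surjective (suc n) y y< with P n in eq
  ... | false = let m , m<n , rest = count-surjective n y y< in m , m<n⇒m<1+n m<n , rest
  ... | true with m≤n⇒m<n∨m≡n (s≤s⁻¹ y<)
  ...   | inj₁ y<c  = let m , m<n , rest = count-surjective n y y<c in m , m<n⇒m<1+n m<n , rest
  ...   | inj₂ refl = n , n<1+n n , subst T (sym eq) _ , refl

  ordinal≼ω : ordinal ≼ ω
  ordinal≼ω = count ∘ proj₁
    , (λ { {m , p} m<n → subst (_≤ _) (count-suc m p) (count-mono (≤⇒≤′ m<n)) })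
    , λ { (n , _) y y< → let m , m<n , p , eq = count-surjective n y y< in (m , p) , m<n , eq }

  limit-unbounded : ∀ {γ} → IsLimit γ → ∀ n → ∃ λ b → [ b ] <⁺ γ × n ≤ proj₁ b
  limit-unbounded ((b , b<γ) , _) zero = b , b<γ , z≤n
  limit-unbounded lim@(_ , dense) (suc n) =
    let b , b<γ , n≤b = limit-unbounded lim n
        d , b<d , d<γ = dense b b<γ
    in d , d<γ , ≤-trans (s≤s n≤b) b<d

  -- Elements with arbitrarily large numbers lie below a limit, but not below `[ b ]`. So `⊤⁺` is
  -- the only possible limit.
  ¬limit-[] : ∀ {b} → ¬ IsLimit [ b ]
  ¬limit-[] {b} lim with limit-unbounded lim (proj₁ b)
  ... | _ , [ a<b ] , b≤a = <⇒≱ a<b b≤a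

  -- Describing γ by its predecessors covers elements of `P` and `⊤⁺` alike. For n = 0 this makes γ
  -- zero; for n = b + 1 with b in `P` it makes γ the successor of b.
  record Least (n : ℕ) (γ : Carrier ⁺) : Set where
    field
      above : ∀ b → proj₁ b < n → [ b ] <⁺ γ
      least : ∀ b → n ≤ proj₁ b → ¬ ([ b ] <⁺ γ)

-- Terms one layer at a time, and agreement to finite depth.

module TermProperties {c : Level} (C : Set c) (⊥ᶜ : C) where

  open Terms C ⊥ᶜ

  data Valid : Symbol → Dir → Set c where
    app-fun  : Valid app fun
    app-arg  : Valid app arg
    lam-body : Valid lam body

  valid? : ∀ x d → Dec (Valid x d)
  valid? (atom _) _    = no λ ()
  valid? app      fun  = yes app-fun
  valid? app      arg  = yes app-arg
  valid? app      body = no λ ()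
  valid? lam      fun  = no λ ()
  valid? lam      arg  = no λ ()
  valid? lam      body = yes lam-body

  node : Symbol → (Dir → Λ∞) → Λ∞
  node x ts .symbol []      = x
  node x ts .symbol (d ∷ p) = symbol (ts d) p

  -- One level of a coinductive comparison, uniform in the kind of root symbol. Invalid directions
  -- are left out because they leave the tree.
  record Layer {a} (A : Rel Λ∞ a) (s t : Λ∞) : Set (c ⊔ˡ a) where
    constructor layer
    field
      root-≡ : root s ≡ root t
      child  : ∀ {d} → Valid (root s) d → A (s / d) (t / d)

  layer-map : ∀ {a b} {A : Rel Λ∞ a} {B : Rel Λ∞ b} → (∀ {s t} → A s t → B s t) →
              ∀ {s t} → Layer A s t → Layer B s t
  layer-map f (layer e ch) = layer e (f ∘ ch)

  layer-sym : ∀ {a b} {A : Rel Λ∞ a} {B : Rel Λ∞ b} → (∀ {s t} → A s t → B t s) →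
              ∀ {s t} → Layer A s t → Layer B t s
  layer-sym f (layer e ch) = layer (sym e) λ v → f (ch (subst (λ x → Valid x _) (sym e) v))

  layer-trans : ∀ {a b d} {A : Rel Λ∞ a} {B : Rel Λ∞ b} {D : Rel Λ∞ d} →
                (∀ {s t u} → A s t → B t u → D s u) →
                ∀ {s t u} → Layer A s t → Layer B t u → Layer D s u
  layer-trans f (layer e ch) (layer e′ ch′) =
    layer (trans e e′) λ v → f (ch v) (ch′ (subst (λ x → Valid x _) e v))

  ‼-valid : ∀ t {d} p → Valid (root t) d → t ‼ (d ∷ p) ≡ (t / d) ‼ p
  ‼-valid t p v with root t | v
  ... | _ | app-fun  = refl
  ... | _ | app-arg  = refl
  ... | _ | lam-body = refl

  ‼-invalid : ∀ t {d} p → ¬ Valid (root t) d → t ‼ (d ∷ p) ≡ nothing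
  ‼-invalid t {d} p ¬v with root t | d
  ... | atom _ | _    = refl
  ... | app    | fun  = contradiction app-fun ¬v
  ... | app    | arg  = contradiction app-arg ¬v
  ... | app    | body = refl
  ... | lam    | fun  = refl
  ... | lam    | arg  = refl
  ... | lam    | body = contradiction lam-body ¬v

  ‼-cong : ∀ s t {d} p → root s ≡ root t → (Valid (root s) d → (s / d) ‼ p ≡ (t / d) ‼ p) →
           s ‼ (d ∷ p) ≡ t ‼ (d ∷ p)
  ‼-cong s t {d} p e f with valid? (root s) d
  ... | yes v = trans (‼-valid s p v) (trans (f v) (sym (‼-valid t p (subst (λ x → Valid x d) e v))))
  ... | no ¬v = trans (‼-invalid s p ¬v) (sym (‼-invalid t p (¬v ∘ subst (λ x → Valid x d) (sym e))))

  ≈-refl : ∀ {s} → s ≈ s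
  ≈-refl p = refl

  ≈-sym : ∀ {s t} → s ≈ t → t ≈ s
  ≈-sym e p = sym (e p)

  ≈-trans : ∀ {s t u} → s ≈ t → t ≈ u → s ≈ u
  ≈-trans e e′ p = trans (e p) (e′ p)

  layer⇒≈ : ∀ {s t} → Layer _≈_ s t → s ≈ t
  layer⇒≈ (layer e ch) []      = cong just e
  layer⇒≈ {s} {t} (layer e ch) (d ∷ p) = ‼-cong s t p e λ v → ch v p

  ≈⇒layer : ∀ {s t} → s ≈ t → Layer _≈_ s t
  ≈⇒layer {s} {t} e = layer root-≡ λ {d} v p →
    trans (sym (‼-valid s p v)) (trans (e (d ∷ p)) (‼-valid t p (subst (λ x → Valid x d) root-≡ v)))
    where root-≡ = just-injective (e [])

  ⌜⌝-η : ∀ {t a} → root t ≡ atom a → ⌜ a ⌝ ≈ t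
  ⌜⌝-η e = layer⇒≈ (layer (sym e) λ ())

  ·-η : ∀ {t} → root t ≡ app → (t / fun) · (t / arg) ≈ t
  ·-η e = layer⇒≈ (layer (sym e) λ { app-fun → ≈-refl ; app-arg → ≈-refl })

  ƛ-η : ∀ {t} → root t ≡ lam → ƛ (t / body) ≈ t
  ƛ-η e = layer⇒≈ (layer (sym e) λ { lam-body → ≈-refl })

  ·-cong : ∀ {s s′ t t′} → s ≈ s′ → t ≈ t′ → s · t ≈ s′ · t′
  ·-cong e e′ = layer⇒≈ (layer refl λ { app-fun → e ; app-arg → e′ })

  ƛ-cong : ∀ {s s′} → s ≈ s′ → ƛ s ≈ ƛ s′
  ƛ-cong e = layer⇒≈ (layer refl λ { lam-body → e })

  -- The n-fold iterate of `Layer` on the total relation. By `↾⇒agree` and `agree⇒↾` it amounts to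
  -- `s ↾ n ≈ t ↾ n`, but it composes layer by layer.
  Agree : ℕ → Rel Λ∞ c
  Agree zero    s t = ⊤
  Agree (suc n) s t = Layer (Agree n) s t

  ≈⇒agree : ∀ n {s t} → s ≈ t → Agree n s t
  ≈⇒agree zero    e = tt
  ≈⇒agree (suc n) e = layer-map (≈⇒agree n) (≈⇒layer e)

  agree-sym : ∀ n {s t} → Agree n s t → Agree n t s
  agree-sym zero    _ = tt
  agree-sym (suc n) l = layer-sym (agree-sym n) l

  agree-trans : ∀ n {s t u} → Agree n s t → Agree n t u → Agree n s u
  agree-trans zero    _ _  = tt
  agree-trans (suc n) l l′ = layer-trans (agree-trans n) l l′

  agree-≤ : ∀ {m n} → m ≤ n → ∀ {s t} → Agree n s t → Agree m s t
  agree-≤ z≤n       _ = tt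
  agree-≤ (s≤s m≤n) l = layer-map (agree-≤ m≤n) l

  agree⇒‼ : ∀ p {s t} → Agree (suc (length p)) s t → s ‼ p ≡ t ‼ p
  agree⇒‼ []      (layer e _)  = cong just e
  agree⇒‼ (d ∷ p) {s} {t} (layer e ch) = ‼-cong s t p e λ v → agree⇒‼ p (ch v)

  agree⇒≈ : ∀ {s t} → (∀ n → Agree n s t) → s ≈ t
  agree⇒≈ ag p = agree⇒‼ p (ag _)

  ↾-root : ∀ n t → root (t ↾ suc n) ≡ root t
  ↾-root n t with root t
  ... | atom _ = refl
  ... | app    = refl
  ... | lam    = refl

  ↾-child : ∀ n t {d} → Valid (root t) d → (t ↾ suc n) / d ≡ (t / d) ↾ n
  ↾-child n t v with root t | v
  ... | _ | app-fun  = refl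
  ... | _ | app-arg  = refl
  ... | _ | lam-body = refl

  -- Truncation commutes with taking children; the `Layer` form lets `layer-trans` chain this with
  -- other layers.
  ↾-layer : ∀ n t → Layer (λ s u → s ≡ u ↾ n) (t ↾ suc n) t
  ↾-layer n t = layer (↾-root n t) λ v → ↾-child n t (subst (λ x → Valid x _) (↾-root n t) v)

  ↾⇒agree : ∀ n {s t} → s ↾ n ≈ t ↾ n → Agree n s t
  ↾⇒agree zero    e = tt
  ↾⇒agree (suc n) {s} {t} e =
    layer-trans (λ { e₁ refl → ↾⇒agree n e₁ })
      (layer-trans {D = λ x u → x ↾ n ≈ u} (λ { refl e₁ → e₁ }) (layer-sym id (↾-layer n s)) (≈⇒layer e))
      (↾-layer n t)

  agree⇒↾ : ∀ n {s t} → Agree n s t → s ↾ n ≈ t ↾ n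
  agree⇒↾ zero    _ = ≈-refl
  agree⇒↾ (suc n) {s} {t} l = layer⇒≈
    (layer-trans (λ { (_ , refl , ag) refl → agree⇒↾ n ag })
      (layer-trans {D = λ x u → ∃ λ y → x ≡ y ↾ n × Agree n y u} (λ e ag → _ , e , ag)
         (↾-layer n s) l)
      (layer-sym id (↾-layer n t)))

  -- Finite reductions at depth at least n.

  module ReductionProperties {r : Level} (R : Rel Λ∞ r) where

    open Reduction R

    Deep : ℕ → Rel Λ∞ (c ⊔ˡ r)
    Deep n s t = s ≈ t ⊎ ∃ λ (σ : s ⟶ t) → n ≤ depth σ

    Chunk : ℕ → Rel Λ∞ (c ⊔ˡ r)
    Chunk n = Star (Deep n)

    deep-resp : ∀ {n s s′ t t′} → s ≈ s′ → Deep n s′ t′ → t′ ≈ t → Deep n s t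
    deep-resp e (inj₁ e′)      e″ = inj₁ (≈-trans e (≈-trans e′ e″))
    deep-resp e (inj₂ (σ , p)) e″ = inj₂ (ident e σ e″ , p)

    -- A contraction of positive depth is not at the root: it keeps the root symbol and takes place
    -- inside one child, one level less deep.
    step⇒layer : ∀ {n s t} (σ : s ⟶ t) → suc n ≤ depth σ → Layer (Deep n) s t
    step⇒layer (appˡ σ) (s≤s p) = layer refl λ { app-fun → inj₂ (σ , p) ; app-arg → inj₁ ≈-refl }
    step⇒layer (appʳ σ) (s≤s p) = layer refl λ { app-fun → inj₁ ≈-refl ; app-arg → inj₂ (σ , p) }
    step⇒layer (abs σ)  (s≤s p) = layer refl λ { lam-body → inj₂ (σ , p) }
    step⇒layer {n} (ident e σ e′) p =
      layer-trans {A = _≈_} {B = λ s t → ∃ λ u → Deep n s u × u ≈ t}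
        (λ { e₁ (u , d , e₂) → deep-resp e₁ d e₂ }) (≈⇒layer e)
        (layer-trans (λ {s} {t} {u} d e₁ → t , d , e₁) (step⇒layer σ p) (≈⇒layer e′))

    deep⇒layer : ∀ {n s t} → Deep (suc n) s t → Layer (Deep n) s t
    deep⇒layer (inj₁ e)       = layer-map inj₁ (≈⇒layer e)
    deep⇒layer (inj₂ (σ , p)) = step⇒layer σ p

    deep⇒agree : ∀ n {s t} → Deep n s t → Agree n s t
    deep⇒agree zero    _ = tt
    deep⇒agree (suc n) d = layer-map (deep⇒agree n) (deep⇒layer d)

    chunk⇒layer : ∀ {n s t} → Chunk (suc n) s t → Layer (Chunk n) s t
    chunk⇒layer ε        = layer refl λ _ → ε
    chunk⇒layer (d ◅ ds) = layer-trans _◅_ (deep⇒layer d) (chunk⇒layer ds)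

    deep-appˡ : ∀ {n s s′ t} → Deep n s s′ → Deep (suc n) (s · t) (s′ · t)
    deep-appˡ (inj₁ e)       = inj₁ (·-cong e ≈-refl)
    deep-appˡ (inj₂ (σ , p)) = inj₂ (appˡ σ , s≤s p)

    deep-appʳ : ∀ {n s s′ t} → Deep n s s′ → Deep (suc n) (t · s) (t · s′)
    deep-appʳ (inj₁ e)       = inj₁ (·-cong ≈-refl e)
    deep-appʳ (inj₂ (σ , p)) = inj₂ (appʳ σ , s≤s p)

    deep-abs : ∀ {n s s′} → Deep n s s′ → Deep (suc n) (ƛ s) (ƛ s′)
    deep-abs (inj₁ e)       = inj₁ (ƛ-cong e)
    deep-abs (inj₂ (σ , p)) = inj₂ (abs σ , s≤s p)

    -- The children are reduced one after the other under the fixed root. The outer identities pass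
    -- between a term and its form as an application or abstraction.
    layer⇒chunk : ∀ {n s t} → Layer (Chunk n) s t → Chunk (suc n) s t
    layer⇒chunk {n} {s} {t} (layer e ch) = go (root s) refl
      where
      child : ∀ {x d} → root s ≡ x → Valid x d → Chunk n (s / d) (t / d)
      child refl = ch

      go : ∀ x → root s ≡ x → Chunk (suc n) s t
      go (atom a) q = inj₁ (≈-trans (≈-sym (⌜⌝-η q)) (⌜⌝-η (trans (sym e) q))) ◅ ε
      go app q = inj₁ (≈-sym (·-η q))
               ◅ gmap (_· (s / arg)) deep-appˡ (child q app-fun)
               ◅◅ gmap ((t / fun) ·_) deep-appʳ (child q app-arg)
               ◅◅ inj₁ (·-η (trans (sym e) q)) ◅ ε
      go lam q = inj₁ (≈-sym (ƛ-η q))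
               ◅ gmap ƛ deep-abs (child q lam-body)
               ◅◅ inj₁ (ƛ-η (trans (sym e) q)) ◅ ε

    RTC⇒chunk : ∀ {s t} → RTC _⟶_ s t → Chunk 0 s t
    RTC⇒chunk = Star.map λ { (inj₁ e) → inj₁ e ; (inj₂ σ) → inj₂ (σ , z≤n) }

    chunk⇒RTC : ∀ {n s t} → Chunk n s t → RTC _⟶_ s t
    chunk⇒RTC = Star.map λ { (inj₁ e) → inj₁ e ; (inj₂ (σ , _)) → inj₂ σ }

    -- The infinitary closure as a coalgebra, and chains of ever deeper finite reductions.

    Coalgebra : Rel Λ∞ (c ⊔ˡ r) → Set (c ⊔ˡ r)
    Coalgebra X = ∀ {s t} → X s t → ∃ λ u → Chunk 0 s u × Layer X u t

    -- The clauses determine the children of t only up to identity, and `X` need not respect `_≈_`,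
    -- so `X` is first closed under identity on the right.
    clause⇒coalgebra : ∀ {X : Rel Λ∞ (c ⊔ˡ r)} → (∀ {s t} → X s t → InfClause _⟶_ X s t) →
                       Coalgebra λ s t → ∃ λ t′ → t ≈ t′ × X s t′
    clause⇒coalgebra {X} cl {s} {t} (t′ , e , x) with cl x
    ... | atom a e′ ρ = ⌜ a ⌝ , RTC⇒chunk ρ ,
          layer (just-injective (≈-sym (≈-trans e e′) [])) λ ()
    ... | app {t₁} {t₂} e′ ρ x₁ x₂ = t₁ · t₂ , RTC⇒chunk ρ ,
          layer-trans {A = X} (λ {_} {t₁} x e₁ → t₁ , ≈-sym e₁ , x)
            (layer refl λ { app-fun → x₁ ; app-arg → x₂ }) (≈⇒layer (≈-sym (≈-trans e e′)))
    ... | lam {u} e′ ρ x₁ = ƛ u , RTC⇒chunk ρ ,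
          layer-trans {A = X} (λ {_} {t₁} x e₁ → t₁ , ≈-sym e₁ , x)
            (layer refl λ { lam-body → x₁ }) (≈⇒layer (≈-sym (≈-trans e e′)))

    coalgebra⇒clause : ∀ {X} → Coalgebra X → ∀ {s t} → X s t → InfClause _⟶_ X s t
    coalgebra⇒clause {X} co {s} {t} x with co x
    ... | u , ρ , layer e ch = go (root u) refl
      where
      child : ∀ {x d} → root u ≡ x → Valid x d → X (u / d) (t / d)
      child refl = ch

      reduces : ∀ {v} → v ≈ u → RTC _⟶_ s v
      reduces e′ = chunk⇒RTC ρ ◅◅ inj₁ (≈-sym e′) ◅ ε

      go : ∀ x → root u ≡ x → InfClause _⟶_ X s t
      go (atom a) q = atom a (≈-sym (⌜⌝-η (trans (sym e) q))) (reduces (⌜⌝-η q))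
      go app q = app (≈-sym (·-η (trans (sym e) q))) (reduces (·-η q))
                     (child q app-fun) (child q app-arg)
      go lam q = lam (≈-sym (ƛ-η (trans (sym e) q))) (reduces (ƛ-η q)) (child q lam-body)

    -- Above depth n the two terms coincide; at depth n, corresponding subterms are related by `X`.
    -- With `X` the relation `Chain 0`, this is infinitary reduction at depth at least n.
    Developed : Rel Λ∞ (c ⊔ˡ r) → ℕ → Rel Λ∞ (c ⊔ˡ r)
    Developed X zero    = X
    Developed X (suc n) = Layer (Developed X n)

    developed⇒agree : ∀ {X} n {s t} → Developed X n s t → Agree n s t
    developed⇒agree zero    _ = tt
    developed⇒agree (suc n) l = layer-map (developed⇒agree n) l

    -- Unfolds `X` once in every subterm at depth n; there are finitely many, so one finite
    -- reduction does it.
    develop : ∀ {X} → Coalgebra X → ∀ n {s t} → Developed X n s t →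
              ∃ λ u → Chunk n s u × Developed X (suc n) u t
    develop co zero x = co x
    develop {X} co (suc n) {s} {t} (layer e ch) =
      node (root s) (λ d → proj₁ (pick d)) ,
      layer⇒chunk (layer refl λ v → proj₁ (proj₂ (pick _) v)) ,
      layer e λ v → proj₂ (proj₂ (pick _) v)
      where
      pick : ∀ d → ∃ λ u → Valid (root s) d →
             Chunk n (s / d) u × Developed X (suc n) u (t / d)
      pick d with valid? (root s) d
      ... | yes v = let u , ρ , l = develop co n (ch v) in u , λ _ → ρ , l
      -- This direction leaves the tree, so any term may fill it.
      ... | no ¬v = s , λ v → contradiction v ¬v

    -- Chain 0 is equivalent to _⟶∞_ but, not quantifying over relations, small
    -- enough to serve as the relation X in InfClosure.
    record Chain (n : ℕ) (s t : Λ∞) : Set (c ⊔ˡ r) where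
      constructor chain
      field
        h     : ℕ → Λ∞
        start : s ≈ h 0
        chunk : ∀ k → Chunk (k + n) (h k) (h (suc k))
        agree : ∀ k → Agree (k + n) (h k) t

    developed⇒chain : ∀ {X} → Coalgebra X → ∀ n {s t} → Developed X n s t → Chain n s t
    developed⇒chain {X} co n {s} {t} l = record
      { h     = proj₁ ∘ iter
      ; start = ≈-refl
      ; chunk = λ k → proj₁ (proj₂ (develop co (k + n) (proj₂ (iter k))))
      ; agree = λ k → developed⇒agree (k + n) (proj₂ (iter k))
      }
      where
      iter : ∀ k → ∃ λ u → Developed X (k + n) u t
      iter zero    = s , l
      iter (suc k) = let u , _ , l = develop co (k + n) (proj₂ (iter k)) in u , l

    -- All steps lie below the root and so split among the children; every `h k` has the root of t,
    -- so the same children are present throughout.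
    chain-layer : ∀ {n t} (h : ℕ → Λ∞) → (∀ k → Chunk (suc (k + n)) (h k) (h (suc k))) →
                  (∀ k → Agree (suc (k + n)) (h k) t) → Layer (Chain n) (h 0) t
    chain-layer {n} {t} h ch ag = layer (Layer.root-≡ (ag 0)) λ {d} v → record
      { h     = λ k → h k / d
      ; start = ≈-refl
      ; chunk = λ k → Layer.child (chunk⇒layer (ch k)) (valid k v)
      ; agree = λ k → Layer.child (ag k) (valid k v)
      }
      where
      valid : ∀ {d} k → Valid (root (h 0)) d → Valid (root (h k)) d
      valid k = subst (λ x → Valid x _) (trans (Layer.root-≡ (ag 0)) (sym (Layer.root-≡ (ag k))))

    chain-resp : ∀ {n s s′ t t′} → s ≈ s′ → t′ ≈ t → Chain n s′ t′ → Chain n s t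
    chain-resp {n} e e′ (chain h st ch ag) =
      chain h (≈-trans e st) ch λ k → agree-trans (k + n) (ag k) (≈⇒agree (k + n) e′)

    -- Chunk 0 is the finite reduction that fixes the root; the chunks from `h 1` on have depth at
    -- least 1 and descend to the children.
    chain-coalgebra : Coalgebra (Chain 0)
    chain-coalgebra (chain h st ch ag) =
      h 1 , inj₁ st ◅ ch 0 , chain-layer (h ∘ suc) (ch ∘ suc) (ag ∘ suc)

    chain⇒developed : ∀ n {s t} → Chain n s t → Developed (Chain 0) n s t
    chain⇒developed zero    x = x
    chain⇒developed (suc n) {t = t} (chain h st ch ag) =
      layer-trans (λ e x → chain⇒developed n (chain-resp e ≈-refl x)) (≈⇒layer st)
        (chain-layer h (λ k → subst (λ m → Chunk m (h k) (h (suc k))) (+-suc k n) (ch k))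
                       (λ k → subst (λ m → Agree m (h k) t) (+-suc k n) (ag k)))

    ⟶∞⇒chain : ∀ {s t} → s ⟶∞ t → Chain 0 s t
    ⟶∞⇒chain {t = t} (X , cl , x) = developed⇒chain (clause⇒coalgebra cl) 0 (t , ≈-refl , x)

    chain⇒⟶∞ : ∀ {s t} → Chain 0 s t → s ⟶∞ t
    chain⇒⟶∞ x = Chain 0 , coalgebra⇒clause chain-coalgebra , x

    -- A step of depth at least n passes through the n fixed layers and arrives in the subterms at
    -- depth n as a step or an identity; there appendability applies.
    developed-deep : Appendable _⟶_ → ∀ n {s t u} →
                     Developed (Chain 0) n s t → Deep n t u → Developed (Chain 0) n s u
    developed-deep ap zero    x (inj₁ e)       = chain-resp ≈-refl e x
    developed-deep ap zero    x (inj₂ (σ , _)) = ⟶∞⇒chain (ap _ _ _ (chain⇒⟶∞ x) σ)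
    developed-deep ap (suc n) l d = layer-trans (developed-deep ap n) l (deep⇒layer d)

    dist⇒agree : ∀ n {s t} → dist[ s , t ]< (2⁻ n) → Agree n s t
    dist⇒agree n (m , e , lt) = agree-≤ (2⁻-cancel-≤ m n lt) (↾⇒agree m e)

    -- From strongly convergent sequences to infinitary reduction.

    module Transfinite (em : ExcludedMiddle 0ℓ) (ap : Appendable _⟶_)
                       {α : Ordinal} {s t : Λ∞} (S : StronglyConvergent α s t) where

      open StronglyConvergent S

      module α  = Ordinal α
      module α⁺ = IsStrictTotalOrder (Supremum.<⁺-isStrictTotalOrder-≡ α._<_ α.isStrictTotalOrder)

      open α using (_<⁺_)
      open Supremum α._<_ using ([_])
      open NonStrict _≡_ _<⁺_ using () renaming (_≤_ to _≤⁺_)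
      open IsTotalOrder (NonStrict.isTotalOrder _≡_ α._<_ α.isStrictTotalOrder)
        using () renaming (trans to ≤-trans′; refl to ≤-refl′; total to ≤-total′)

      ≮⁺⇒≤⁺ : ∀ {β γ} → ¬ (γ <⁺ β) → β ≤⁺ γ
      ≮⁺⇒≤⁺ {β} {γ} γ≮β with α⁺.compare β γ
      ... | tri< β<γ _ _ = inj₁ β<γ
      ... | tri≈ _ β≡γ _ = inj₂ β≡γ
      ... | tri> _ _ γ<β = contradiction γ<β γ≮β

      []-mono : ∀ {a b} → a α.≤ b → [ a ] ≤⁺ [ b ]
      []-mono (inj₁ a<b)  = inj₁ [ a<b ]
      []-mono (inj₂ refl) = inj₂ refl

      []-cancel : ∀ {a b} → [ a ] ≤⁺ [ b ] → a α.≤ b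
      []-cancel (inj₁ [ a<b ]) = inj₁ a<b
      []-cancel (inj₂ refl)    = inj₂ refl

      upper-bound : ∀ {γ} a b → [ a ] <⁺ γ → [ b ] <⁺ γ → ∃ λ d → [ d ] <⁺ γ × a α.≤ d × b α.≤ d
      upper-bound a b a<γ b<γ with ≤-total′ a b
      ... | inj₁ a≤b = b , b<γ , a≤b , ≤-refl′
      ... | inj₂ b≤a = a , a<γ , ≤-refl′ , b≤a

      DeepOn : ℕ → α.Carrier ⁺ → α.Carrier ⁺ → Set
      DeepOn n β γ = ∀ b → β ≤⁺ [ b ] → [ b ] <⁺ γ → n ≤ depth (σ b)

      -- General in n and β because the limit case applies the hypothesis between two indices below
      -- the limit, for ever larger n.
      Extends : α.Carrier ⁺ → Set (c ⊔ˡ r)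
      Extends γ = ∀ n {w} β → β ≤⁺ γ → DeepOn n β γ →
                  Developed (Chain 0) n w (f β) → Developed (Chain 0) n w (f γ)

      -- Stage k has reached an index from which on all steps have depth ≥ k.
      -- One further chunk of depth ≥ k then settles depth k: the induction
      -- hypothesis moves to a later index, closer to f γ and with deeper steps
      -- beyond it, and the term is developed one level further.
      extends-limit : ∀ {γ} → α.IsLimit γ → (∀ b → [ b ] <⁺ γ → Extends [ b ]) →
                      ∀ n {w} b → [ b ] <⁺ γ → DeepOn n [ b ] γ →
                      Developed (Chain 0) n w (f [ b ]) → Developed (Chain 0) n w (f γ)
      extends-limit {γ} lim ih n {w} b b<γ deep x = chain⇒developed n record
        { h     = λ k → Stage.term (stage k)
        ; start = ≈-refl
        ; chunk = λ k → proj₁ (proj₂ (advance (k + n) (stage k)))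
        ; agree = λ k → proj₂ (proj₂ (advance (k + n) (stage k)))
        }
        where
        record Stage (k : ℕ) : Set (c ⊔ˡ r) where
          field
            term      : Λ∞
            index     : α.Carrier
            index<γ   : [ index ] <⁺ γ
            deepOn    : DeepOn k [ index ] γ
            developed : Developed (Chain 0) k term (f [ index ])

        advance : ∀ k (x : Stage k) → ∃ λ (y : Stage (suc k)) →
                  Chunk k (Stage.term x) (Stage.term y) × Agree k (Stage.term x) (f γ)
        advance k x with deepens γ lim k | converges γ lim (2⁻ k) (2⁻-positive k)
        ... | b₁ , b₁<γ , deep₁ | b₂ , b₂<γ , near₂
          with upper-bound _ _ b₁<γ b₂<γ
        ... | b₃ , b₃<γ , b₁≤b₃ , b₂≤b₃
          with upper-bound _ _ (Stage.index<γ x) b₃<γ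
        ... | b₄ , b₄<γ , i≤b₄ , b₃≤b₄
          with ih b₄ b₄<γ k [ Stage.index x ] ([]-mono i≤b₄)
                  (λ a i≤a a<b₄ → Stage.deepOn x a i≤a (α⁺.trans a<b₄ b₄<γ)) (Stage.developed x)
        ... | dev
          with develop chain-coalgebra k dev
        ... | u , ρ , l = record
          { term      = u
          ; index     = b₄
          ; index<γ   = b₄<γ
          ; deepOn    = λ a b₄≤a → deep₁ a (≤-trans′ b₁≤b₃ (≤-trans′ b₃≤b₄ ([]-cancel b₄≤a)))
          ; developed = l
          } , ρ , agree-trans k (developed⇒agree k dev)
                    (dist⇒agree k (near₂ b₄ (≤-trans′ b₂≤b₃ b₃≤b₄) b₄<γ))

        stage : ∀ k → Stage (k + n)
        stage zero    = record { term = w ; index = b ; index<γ = b<γ ; deepOn = deep ; developed = x }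
        stage (suc k) = proj₁ (advance (k + n) (stage k))

      extends-step : ∀ γ → (∀ b → [ b ] <⁺ γ → Extends [ b ]) → Extends γ
      extends-step γ ih n β (inj₂ refl) deep x = x
      -- Excluded middle separates the successors; any other γ is a limit, since β lies below it.
      extends-step γ ih n β (inj₁ β<γ) deep x with em {∃ λ a → next a ≡ γ}
      ... | yes (a , refl) = developed-deep ap n
            (ih a a<γ n β β≤a (λ b β≤b b<a → deep b β≤b (α⁺.trans b<a a<γ)) x)
            (inj₂ (σ a , deep a β≤a a<γ))
        where
        a<γ = proj₁ (next-ok a)
        β≤a = ≮⁺⇒≤⁺ λ a<β → proj₂ (next-ok a) β a<β β<γ
      extends-step γ ih n [ b ] (inj₁ b<γ) deep x | no ¬succ =
        extends-limit ((b , b<γ) , dense) ih n b b<γ deep x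
        where
        -- The successor of a is not γ, and it cannot exceed γ because γ lies above a; so it lies
        -- below γ and is the required element.
        dense : ∀ a → [ a ] <⁺ γ → ∃ λ d → a α.< d × [ d ] <⁺ γ
        dense a a<γ with next a in eq | next-ok a
        ... | δ | a<δ , none with α⁺.compare δ γ
        ... | tri≈ _ δ≡γ _ = contradiction (a , trans eq δ≡γ) ¬succ
        ... | tri> _ _ γ<δ = contradiction γ<δ (none γ a<γ)
        dense a a<γ | [ d ] | [ a<d ] , none | tri< d<γ _ _ = d , a<d , d<γ

      extends-acc : ∀ {b} → Acc α._<_ b → Extends [ b ]
      extends-acc {b} (acc rs) = extends-step [ b ] λ { a [ a<b ] → extends-acc (rs a<b) }

      extends : ∀ γ → Extends γ
      extends γ = extends-step γ λ b _ → extends-acc (α.wellFounded b)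

      stronglyConvergent⇒chain : Chain 0 s t
      stronglyConvergent⇒chain = chain-resp (≈-sym start) end
        -- At n = 0 the depth condition is vacuous, and the constant chain reduces `f least` to
        -- itself.
        (extends ⊤⁺ 0 least (≮⁺⇒≤⁺ λ ()) (λ _ _ _ → z≤n)
          (chain (λ _ → f least) ≈-refl (λ _ → ε) λ k → ≈⇒agree (k + 0) ≈-refl))

    -- Concatenation of the chunks into one sequence indexed by ℕ.

    record LazySequence (s t : Λ∞) : Set (c ⊔ˡ r) where
      field
        g         : ℕ → Λ∞
        level     : ℕ → ℕ
        start     : g 0 ≈ s
        step      : ∀ i → Deep (level i) (g i) (g (suc i))
        agree     : ∀ i → Agree (level i) (g i) t
        unbounded : ∀ n → ∃ λ i → ∀ j → i ≤ j → n ≤ level j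

    -- An identity step marks the end of each chunk, so that even an empty chunk occupies an index
    -- and the sequence never stops.
    chain⇒lazySequence : ∀ {s t} → Chain 0 s t → LazySequence s t
    chain⇒lazySequence {s} {t} (chain h st ch ag) = record
      { g         = State.term ∘ state
      ; level     = λ i → State.stage (state i) + 0
      ; start     = ≈-sym st
      ; step      = step ∘ state
      ; agree     = State.agree ∘ state
      ; unbounded = λ n → let i , n≤i = unbounded n in
          i , λ j i≤j → ≤-trans n≤i (≤-trans (stage-mono (≤⇒≤′ i≤j)) (m≤m+n _ 0))
      }
      where
      record State : Set (c ⊔ˡ r) where
        constructor mk
        eta-equality
        field
          stage : ℕ
          term  : Λ∞
          rest  : Chunk (stage + 0) term (h (suc stage))
          agree : Agree (stage + 0) term t

      open State using (stage; term; rest)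

      next : State → State
      next (mk k _ ε _)        = mk (suc k) _ (ch (suc k)) (ag (suc k))
      next (mk k _ (d ◅ ds) a) = mk k _ ds (agree-trans (k + 0) (agree-sym (k + 0) (deep⇒agree (k + 0) d)) a)

      step : ∀ x → Deep (stage x + 0) (term x) (term (next x))
      step (mk _ _ ε _)       = inj₁ ≈-refl
      step (mk _ _ (d ◅ _) _) = d

      stage-next : ∀ x → stage x ≤ stage (next x)
      stage-next (mk k _ ε _)       = n≤1+n k
      stage-next (mk _ _ (_ ◅ _) _) = ≤-refl

      state : ℕ → State
      state zero    = mk 0 (h 0) (ch 0) (ag 0)
      state (suc i) = next (state i)

      stage-mono : ∀ {i j} → i ≤′ j → stage (state i) ≤ stage (state j)
      stage-mono ≤′-refl              = ≤-refl
      stage-mono (≤′-step {n = j} le) = ≤-trans (stage-mono le) (stage-next (state j))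

      -- Induction on the rest of the chunk, which `next` shortens by one step at a time.
      stage-reached : ∀ {k u} (ds : Chunk (k + 0) u (h (suc k))) a i → state i ≡ mk k u ds a →
                      ∃ λ j → stage (state j) ≡ suc k
      stage-reached ε        a i eq = suc i , cong (stage ∘ next) eq
      stage-reached (_ ◅ ds) a i eq = stage-reached ds _ (suc i) (cong next eq)

      unbounded : ∀ n → ∃ λ i → n ≤ stage (state i)
      unbounded zero    = 0 , z≤n
      unbounded (suc n) =
        let i , n≤i = unbounded n
            j , eq  = stage-reached (rest (state i)) _ i refl
        in j , subst (suc n ≤_) (sym eq) (s≤s n≤i)

    -- Deletion of the identity steps.

    module Compression (em : ExcludedMiddle 0ℓ) {s t : Λ∞} (L : LazySequence s t) where

      open LazySequence L

      -- A strongly convergent sequence has a contraction at every index, so only the indices that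
      -- carry one are kept.
      proper : ℕ → Bool
      proper i = [ (λ _ → false) , (λ _ → true) ]′ (step i)

      open Restriction proper
      open Ordinal ordinal using (Carrier; IsLimit; _<⁺_)
      open Supremum (Ordinal._<_ ordinal) using ([_]; [_]<⊤⁺)

      properStep : ∀ i → T (proper i) → ∃ λ (σ : g i ⟶ g (suc i)) → level i ≤ depth σ
      properStep i p with inj₂ σ ← step i = σ

      improperStep : ∀ i → ¬ T (proper i) → g i ≈ g (suc i)
      improperStep i ¬p with step i
      ... | inj₁ e = e
      ... | inj₂ _ = contradiction _ ¬p

      f : Carrier ⁺ → Λ∞
      f [ i , _ ] = g i
      f ⊤⁺        = t

      -- From i on all terms are identical, while they agree with t to unbounded depth.
      stationary : ∀ i → (∀ j → i ≤ j → ¬ T (proper j)) → g i ≈ t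
      stationary i none = agree⇒≈ λ n →
        let j , n≤ = unbounded n
            e      = constant (≤⇒≤′ (m≤m⊔n i j))
        in agree-trans n (≈⇒agree n e) (agree-≤ (n≤ (i ⊔ j) (m≤n⊔m i j)) (agree (i ⊔ j)))
        where
        constant : ∀ {j} → i ≤′ j → g i ≈ g j
        constant ≤′-refl               = ≈-refl
        constant (≤′-step {n = j} i≤j) = ≈-trans (constant i≤j) (improperStep j (none j (≤′⇒≤ i≤j)))

      -- Excluded middle decides whether a contraction remains; if so, a bounded search finds the
      -- first. Only identities are skipped, so the term stays the same. This yields both the least
      -- index and successors.
      nextProper : ∀ i → ∃ λ γ → Least i γ × g i ≈ f γ
      nextProper i with em {∃ λ j → i ≤ j × T (proper j)}
      ... | no none = ⊤⁺ , record
            { above = λ b _ → [ b ]<⊤⁺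
            ; least = λ { (j , p) i≤j _ → none (j , i≤j , p) }
            } , stationary i λ j i≤j p → none (j , i≤j , p)
      ... | yes (j , i≤j , p) = search (≤⇒≤‴ i≤j)
        where
        search : ∀ {i} → i ≤‴ j → ∃ λ γ → Least i γ × g i ≈ f γ
        search {i} i≤j with T? (proper i)
        ... | yes q = [ i , q ] , record
              { above = λ _ → [_]
              ; least = λ { _ i≤b [ b<i ] → <⇒≱ b<i i≤b }
              } , ≈-refl
        search ≤‴-refl | no ¬q = contradiction p ¬q
        search {i} (≤‴-step i<j) | no ¬q with search i<j
        ... | γ , l , e = γ , record
              { above = λ b b<i → Least.above l b (m<n⇒m<1+n b<i)
              ; least = λ b i≤b → [ Least.least l b
                                  , (λ { refl → contradiction (proj₂ b) ¬q }) ]′ (m≤n⇒m<n∨m≡n i≤b)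
              } , ≈-trans (improperStep i ¬q) e

      level-eventually : ∀ {γ} → IsLimit γ → ∀ n → ∃ λ b → [ b ] <⁺ γ ×
                         (∀ b′ → Ordinal._≤_ ordinal b b′ → n ≤ level (proj₁ b′))
      level-eventually lim n =
        let i , n≤          = unbounded n
            b , b<γ , i≤b   = limit-unbounded lim i
        in b , b<γ , λ { b′ (inj₁ b<b′) → n≤ _ (≤-trans i≤b (<⇒≤ b<b′)) ; b′ (inj₂ refl) → n≤ _ i≤b }

      stronglyConvergent : StronglyConvergent ordinal s t
      stronglyConvergent = record
        { f         = f
        ; least     = proj₁ (nextProper 0)
        ; least-ok  = λ { [ b ] → Least.least (proj₁ (proj₂ (nextProper 0))) b z≤n ; ⊤⁺ () }
        ; start     = ≈-trans (≈-sym (proj₂ (proj₂ (nextProper 0)))) start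
        ; end       = ≈-refl
        ; next      = λ b → proj₁ (nextProper (suc (proj₁ b)))
        ; next-ok   = λ b → let l = proj₁ (proj₂ (nextProper (suc (proj₁ b)))) in
            Least.above l b ≤-refl , λ { [ d ] [ b<d ] → Least.least l d b<d ; ⊤⁺ _ () }
        -- `ident` absorbs the identities up to the next kept index without changing the depth.
        ; σ         = λ { (i , p) →
            ident ≈-refl (proj₁ (properStep i p)) (proj₂ (proj₂ (nextProper (suc i)))) }
        ; converges = λ
          { [ _ ] lim → contradiction lim ¬limit-[]
          ; ⊤⁺ lim δ δ>0 →
              let n , 2⁻n<δ      = 2⁻-archimedean δ δ>0
                  b , b<γ , deep = level-eventually lim n
              in b , b<γ , λ b′ b≤b′ _ →
                   n , agree⇒↾ n (agree-≤ (deep b′ b≤b′) (agree (proj₁ b′))) , 2⁻n<δ }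
        ; deepens   = λ γ lim d →
            -- `suc d`, since the depth has to exceed d strictly.
            let b , b<γ , deep = level-eventually lim (suc d)
            in b , b<γ , λ { b′@(i , p) b≤b′ _ → ≤-trans (deep b′ b≤b′) (proj₂ (properStep i p)) }
        }

theorem5p45 : ExcludedMiddle 0ℓ →
    ∀ {c r} (C : Set c) (⊥ᶜ : C) →
    let open Terms C ⊥ᶜ in
    (R : Rel Λ∞ r) →
    let open Reduction R in
    Appendable _⟶_ →
    ∀ s t →
    (s ⟶∞ t ⇔ (∃ λ α → StronglyConvergent α s t))
    × (s ⟶∞ t → ∃ λ α → α ≼ ω × StronglyConvergent α s t)
theorem5p45 em C ⊥ᶜ R ap s t =
  mk⇔ (λ x → let α , _ , S = compress x in α , S)
      (λ { (_ , S) → chain⇒⟶∞ (Transfinite.stronglyConvergent⇒chain em ap S) })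
  , compress
  where
  open Terms C ⊥ᶜ
  open Reduction R
  open TermProperties C ⊥ᶜ
  open ReductionProperties R

  compress : s ⟶∞ t → ∃ λ α → α ≼ ω × StronglyConvergent α s t
  compress x = ordinal , ordinal≼ω , stronglyConvergent
    where
    open Compression em (chain⇒lazySequence (⟶∞⇒chain x))
    open Restriction proper
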